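{- For every positive integer $t$, if $n$ is sufficiently large in terms of $t$, then $\mathrm{ex}(n,F_{t,t})\le 5t^{3/2}n^{3/2}$.
   Context: $\mathrm{ex}(n,F)$ is the maximum number of edges in an $n$-vertex graph with no subgraph isomorphic to $F$. The grid $F_{t,t}$ is the graph with vertex set $[t]\times[t]$ in which two vertices are adjacent if and only if they differ in exactly one coordinate and in that coordinate they differ by exactly one. -}

module Defs where

open import Data.Bool.Base using (true; false; if_then_else_)
open import Data.Empty using (⊥-elim)
open import Data.Fin.Base using (Fin; zero; suc; toℕ; combine; remQuot; finToFun; funToFin)
open import Data.Fin.Properties using (_≟_; _<?_; all?; any?; *↔×; finToFun-funToFin)
open import Data.List.Base using (List; length; filter; map; allFin; cartesianProduct)
open import Data.List.Extrema.Nat using (max; xs≤max; max≤v⁺; argmax-sel)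
open import Data.List.Membership.Propositional using (_∈_)
open import Data.List.Membership.Propositional.Properties
  using (∈-map⁺; ∈-map⁻; ∈-filter⁺; ∈-filter⁻; ∈-allFin)
open import Data.List.Properties using (filter-≐)
import Data.List.Relation.Unary.All as All
open import Data.Nat.Base using (ℕ; _≤_; _*_; _^_; z≤n; ∣_-_∣)
import Data.Nat.Properties as ℕ
open import Data.Product.Base using (Σ; ∃; ∃-syntax; _×_; _,_; proj₁; proj₂)
open import Data.Sum.Base using (_⊎_; inj₁; inj₂; swap; [_,_])
open import Function.Base using (id; _∘_)
open import Function.Bundles using (_↔_; module Inverse)
open import Function.Definitions using (Injective)
open import Level using (0ℓ)
open import Relation.Binary.Core using (Rel)
open import Relation.Binary.Definitions using (Symmetric; Irreflexive; Decidable)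
open import Relation.Binary.PropositionalEquality
  using (_≡_; _≢_; refl; sym; trans; cong; subst; subst₂)
open import Relation.Nullary using (Dec; yes; no; ¬_)
open import Relation.Nullary.Decidable using (map′; ¬?; _×-dec_; _⊎-dec_; _→-dec_)

record Graph (V : Set) : Set₁ where
  infix 4 _~_ _~?_
  field
    _~_      : Rel V 0ℓ
    ~-sym    : Symmetric _~_
    ~-irrefl : Irreflexive _≡_ _~_
    _~?_     : Decidable _~_

edges : ∀ {n} → Graph (Fin n) → List (Fin n × Fin n)
edges {n} G =
  filter (λ (u , v) → (u <? v) ×-dec (u ~? v)) (cartesianProduct (allFin n) (allFin n))
  where open Graph G

edgeCount : ∀ {n} → Graph (Fin n) → ℕ
edgeCount G = length (edges G)

-- The images of the vertices and edges of F under f form a subgraph of G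
-- isomorphic to F, and every such subgraph arises in this way; the subgraph
-- need not be induced.
_IsSubgraphOf_ : ∀ {V W} → Graph V → Graph W → Set
F IsSubgraphOf G = ∃[ f ] Injective _≡_ _≡_ f × (∀ {u v} → u F.~ v → f u G.~ f v)
  where
  module F = Graph F
  module G = Graph G

_FreeOf_ : ∀ {V W} → Graph W → Graph V → Set
G FreeOf F = ¬ F IsSubgraphOf G

isSubgraphOf? : ∀ {k n V} → Fin k ↔ V → (F : Graph V) (G : Graph (Fin n)) →
                Dec (F IsSubgraphOf G)
isSubgraphOf? {k} {n} {V} enum F G = map′ fromCode toCode (any? (copy? ∘ finToFun))
  where
  module F = Graph F
  module G = Graph G
  open Inverse enum

  IsCopy : (Fin k → Fin n) → Set
  IsCopy g = (∀ i j → g i ≡ g j → i ≡ j) × (∀ i j → to i F.~ to j → g i G.~ g j)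

  copy? : ∀ g → Dec (IsCopy g)
  copy? g = all? (λ i → all? λ j → (g i ≟ g j) →-dec (i ≟ j))
      ×-dec all? (λ i → all? λ j → (to i F.~? to j) →-dec (g i G.~? g j))

  to-from : ∀ v → to (from v) ≡ v
  to-from v = inverseˡ refl

  from-injective : ∀ {u v} → from u ≡ from v → u ≡ v
  from-injective {u} {v} eq = trans (sym (to-from u)) (trans (cong to eq) (to-from v))

  to-injective : ∀ {i j} → to i ≡ to j → i ≡ j
  to-injective eq = trans (sym (inverseʳ refl)) (trans (cong from eq) (inverseʳ refl))

  fromCode : (∃ λ (c : Fin (n ^ k)) → IsCopy (finToFun c)) → F IsSubgraphOf G
  fromCode (c , inj , hom) =
    finToFun c ∘ from ,
    (λ eq → from-injective (inj _ _ eq)) ,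
    (λ {u} {v} u~v → hom _ _ (subst₂ F._~_ (sym (to-from u)) (sym (to-from v)) u~v))

  toCode : F IsSubgraphOf G → ∃ λ (c : Fin (n ^ k)) → IsCopy (finToFun c)
  toCode (f , inj , hom) =
    funToFin (f ∘ to) ,
    (λ i j eq → to-injective (inj (trans (sym (code i)) (trans eq (code j))))) ,
    (λ i j i~j → subst₂ G._~_ (sym (code i)) (sym (code j)) (hom i~j))
    where code = finToFun-funToFin (f ∘ to)

-- Each number c < 2^(n²) encodes an n × n matrix over {0,1}; the decoded graph
-- joins u ≢ v when the (u,v) or (v,u) entry is 1.
decode : ∀ {n} → Fin (2 ^ (n * n)) → Graph (Fin n)
decode {n} c = record
  { _~_      = λ u v → u ≢ v × (bit u v ≡ suc zero ⊎ bit v u ≡ suc zero)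
  ; ~-sym    = λ (u≢v , b) → u≢v ∘ sym , swap b
  ; ~-irrefl = λ u≡v (u≢v , _) → u≢v u≡v
  ; _~?_     = λ u v → ¬? (u ≟ v) ×-dec ((bit u v ≟ suc zero) ⊎-dec (bit v u ≟ suc zero))
  }
  where
  bit : Fin n → Fin n → Fin 2
  bit u v = finToFun c (combine u v)

-- Contains every graph on Fin n up to equivalence of adjacency relations
-- (see graphs-complete), possibly with repetitions.
graphs : ∀ n → List (Graph (Fin n))
graphs n = map decode (allFin (2 ^ (n * n)))

-- If no n-vertex graph is F-free, the value is 0.
ex : ∀ {k V} → ℕ → Fin k ↔ V → Graph V → ℕ
ex n enum F = max 0 (map edgeCount (filter (λ G → ¬? (isSubgraphOf? enum F G)) (graphs n)))

infix 4 _≈ᴳ_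
_≈ᴳ_ : ∀ {V} → Graph V → Graph V → Set
G ≈ᴳ H = ∀ {u v} → (u G.~ v → u H.~ v) × (u H.~ v → u G.~ v)
  where
  module G = Graph G
  module H = Graph H

edgeCount-cong : ∀ {n} {G H : Graph (Fin n)} → G ≈ᴳ H → edgeCount G ≡ edgeCount H
edgeCount-cong {n} {G} {H} G≈H =
  cong length (filter-≐ (λ (u , v) → (u <? v) ×-dec (u G.~? v))
                        (λ (u , v) → (u <? v) ×-dec (u H.~? v))
                        ( (λ (u<v , u~v) → u<v , proj₁ G≈H u~v)
                        , (λ (u<v , u~v) → u<v , proj₂ G≈H u~v))
                        (cartesianProduct (allFin n) (allFin n)))
  where
  module G = Graph G
  module H = Graph H

graphs-complete : ∀ {n} (G : Graph (Fin n)) → ∃[ H ] H ∈ graphs n × G ≈ᴳ H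
graphs-complete {n} G = decode c , ∈-map⁺ decode (∈-allFin c) , to , from
  where
  open Graph G

  entry : Fin n × Fin n → Fin 2
  entry (u , v) with u ~? v
  ... | yes _ = suc zero
  ... | no  _ = zero

  entry⁺ : ∀ {u v} → u ~ v → entry (u , v) ≡ suc zero
  entry⁺ {u} {v} u~v with u ~? v
  ... | yes _   = refl
  ... | no  u≁v = ⊥-elim (u≁v u~v)

  entry⁻ : ∀ {u v} → entry (u , v) ≡ suc zero → u ~ v
  entry⁻ {u} {v} eq with u ~? v
  entry⁻ _  | yes u~v = u~v
  entry⁻ () | no  _

  c : Fin (2 ^ (n * n))
  c = funToFin (entry ∘ remQuot n)

  bit≡entry : ∀ u v → finToFun c (combine u v) ≡ entry (u , v)
  bit≡entry u v = trans (finToFun-funToFin (entry ∘ remQuot n) (combine u v))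
                        (cong entry (Inverse.inverseˡ (*↔× {n} {n}) refl))

  to : ∀ {u v} → u ~ v → Graph._~_ (decode c) u v
  to {u} {v} u~v = (λ u≡v → ~-irrefl u≡v u~v) , inj₁ (trans (bit≡entry u v) (entry⁺ u~v))

  from : ∀ {u v} → Graph._~_ (decode c) u v → u ~ v
  from {u} {v} (_ , b) =
    [ (λ e → entry⁻ (trans (sym (bit≡entry u v)) e))
    , (λ e → ~-sym (entry⁻ (trans (sym (bit≡entry v u)) e))) ] b

module _ {k V} (enum : Fin k ↔ V) (F : Graph V) (n : ℕ) where

  private
    free? : ∀ (G : Graph (Fin n)) → Dec (G FreeOf F)
    free? G = ¬? (isSubgraphOf? enum F G)

    member : ∀ {x} → x ∈ map edgeCount (filter free? (graphs n)) →
             ∃[ G ] G FreeOf F × edgeCount G ≡ x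
    member x∈ with ∈-map⁻ edgeCount x∈
    ... | G , G∈ , eq = G , proj₂ (∈-filter⁻ free? {xs = graphs n} G∈) , sym eq

  ex-upper : ∀ G → G FreeOf F → edgeCount G ≤ ex n enum F
  ex-upper G free with graphs-complete G
  ... | H , H∈ , G≈H =
    subst (_≤ ex n enum F) (sym (edgeCount-cong {G = G} {H = H} G≈H))
      (All.lookup (xs≤max 0 _) (∈-map⁺ edgeCount (∈-filter⁺ free? H∈ H-free)))
    where
    H-free : H FreeOf F
    H-free (f , inj , hom) = free (f , inj , λ u~v → proj₂ G≈H (hom u~v))

  ex-least : ∀ m → (∀ G → G FreeOf F → edgeCount G ≤ m) → ex n enum F ≤ m
  ex-least m bound = max≤v⁺ z≤n (All.tabulate λ x∈ →
    let G , free , eq = member x∈ in subst (_≤ m) eq (bound G free))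

  ex-attained : (Σ (Graph (Fin n)) (_FreeOf F)) →
                Σ (Graph (Fin n)) λ G → G FreeOf F × edgeCount G ≡ ex n enum F
  ex-attained (G , free) with argmax-sel id 0 (map edgeCount (filter free? (graphs n)))
  ... | inj₂ ex∈  = member ex∈
  ... | inj₁ ex≡0 = G , free , trans
    (ℕ.n≤0⇒n≡0 (subst (edgeCount G ≤_) ex≡0 (ex-upper G free))) (sym ex≡0)

-- The coordinates 0, …, t - 1 stand for 1, …, t.
grid : ∀ t → Graph (Fin t × Fin t)
grid t = record
  { _~_      = λ (i , j) (i′ , j′) → (i ≡ i′ × Near j j′) ⊎ (Near i i′ × j ≡ j′)
  ; ~-sym    = λ { {i , j} {i′ , j′} (inj₁ (p , q)) → inj₁ (sym p , near-sym j j′ q)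
                 ; {i , j} {i′ , j′} (inj₂ (p , q)) → inj₂ (near-sym i i′ p , sym q) }
  ; ~-irrefl = λ { {_ , j} refl (inj₁ (_ , q)) → near-irrefl j q
                 ; {i , _} refl (inj₂ (p , _)) → near-irrefl i p }
  ; _~?_     = λ (i , j) (i′ , j′) →
                 ((i ≟ i′) ×-dec near? j j′) ⊎-dec (near? i i′ ×-dec (j ≟ j′))
  }
  where
  Near : Fin t → Fin t → Set
  Near i j = ∣ toℕ i - toℕ j ∣ ≡ 1

  near? : ∀ i j → Dec (Near i j)
  near? i j = ∣ toℕ i - toℕ j ∣ ℕ.≟ 1

  near-sym : ∀ i j → Near i j → Near j i
  near-sym i j = trans (ℕ.∣-∣-comm (toℕ j) (toℕ i))

  near-irrefl : ∀ i → ¬ Near i i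
  near-irrefl i eq with () ← trans (sym (ℕ.∣n-n∣≡0 (toℕ i))) eq

gridVertices : ∀ t → Fin (t * t) ↔ (Fin t × Fin t)
gridVertices t = *↔×

{-# OPTIONS --safe #-}
module Submission where

-- Put s = t² and m = 2t - 1.  Suppose that a family of walks v₀ … vₘ₊₁ is such
-- that each interior vertex of each member can be exchanged, within the family,
-- for one outside any prescribed set of s vertices.  Then a grid is swept out
-- cell by cell: the grid diagonals correspond to the interior positions, and
-- filling a cell exchanges the vertex in the position of its diagonal, which at
-- that moment lies between the vertices of the two neighbouring filled cells.
--
-- To find such a family, delete edges until all degrees are 0 or exceed δ, where
-- δ ≈ e/(4n), and give a walk the weight ∏ 1/deg(vᵢ) over its interior vertices.
-- The walks have total weight at least e/2.  Whenever all but one interior vertex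
-- are fixed and at most s walks remain, delete these; for one position this
-- costs at most s n²/δ in all.  Some walk survives because m s n²/δ < e/2.

open import Defs
open import Data.Empty using (⊥-elim)
open import Data.Fin.Base using (Fin; zero; suc; toℕ)
import Data.Fin.Properties as Fin
open import Data.List.Base
  using (List; []; _∷_; _++_; [_]; map; length; filter; lookup; tabulate; allFin; _ʳ++_;
         cartesianProduct; cartesianProductWith)
import Data.List.Membership.DecPropositional as DecMembership
open import Data.List.Membership.Propositional using (_∈_; _∉_; find; lose)
open import Data.List.Membership.Propositional.Properties
  using (∈-++⁺ˡ; ∈-++⁺ʳ; ∈-++⁻; ∈-∃++; ∈-map⁺; ∈-map⁻; ∈-allFin; ∈-tabulate⁺;
         ∈-cartesianProduct⁺; ∈-cartesianProductWith⁺; ∈-cartesianProductWith⁻)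
open import Data.List.Properties
  using (map-++; map-∘; length-++; length-ʳ++; length-tabulate; tabulate-lookup; ++-identityʳ;
         ≡-dec; ∷-injective)
import Data.List.Relation.Unary.All as All
import Data.List.Relation.Unary.AllPairs as AllPairs
open import Data.List.Relation.Unary.Any using (any?; here; there)
open import Data.List.Relation.Unary.Unique.Propositional using (Unique)
import Data.List.Relation.Unary.Unique.Propositional.Properties as Unique
open import Data.Nat.Base
open import Data.Nat.Divisibility using (_∣_; divides; ∣-trans; m≤n⇒m!∣n!; m∣m*n)
open import Data.Nat.DivMod using (_/_; _%_; m/n*n≤m; m≡m%n+[m/n]*n; m%n<n)
open import Data.Nat.ListAction using (sum)
open import Data.Nat.ListAction.Properties using (sum-++)
open import Data.Nat.Properties
open import Data.Nat.Tactic.RingSolver using (solve-∀)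
open import Data.Product.Base using (∃-syntax; Σ-syntax; _×_; _,_; proj₁; proj₂)
import Data.Product.Properties as Product
open import Data.Sum.Base using (_⊎_; inj₁; inj₂)
open import Data.Unit.Base using (⊤; tt)
import Data.Vec.Functional as Vector
open import Function.Base using (_∘_; id)
open import Relation.Binary.Definitions using (DecidableEquality)
open import Relation.Binary.PropositionalEquality
  using (_≡_; _≢_; refl; sym; trans; cong; cong₂; subst; module ≡-Reasoning)
open import Relation.Nullary using (Dec; yes; no)
open import Relation.Nullary.Decidable using (¬?; _×-dec_; decidable-stable)

-- Sums over lists.

private variable
  A B C : Set

∑ : List A → (A → ℕ) → ℕ
∑ xs f = sum (map f xs)

∑-++ : ∀ (xs ys : List A) f → ∑ (xs ++ ys) f ≡ ∑ xs f + ∑ ys f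
∑-++ xs ys f = trans (cong sum (map-++ f xs ys)) (sum-++ (map f xs) (map f ys))

∑-map : ∀ (g : A → B) xs f → ∑ (map g xs) f ≡ ∑ xs (f ∘ g)
∑-map g xs f = cong sum (sym (map-∘ xs))

∑-cong : ∀ (xs : List A) {f g : A → ℕ} → (∀ x → f x ≡ g x) → ∑ xs f ≡ ∑ xs g
∑-cong []       eq = refl
∑-cong (x ∷ xs) eq = cong₂ _+_ (eq x) (∑-cong xs eq)

∑-mono : ∀ (xs : List A) {f g : A → ℕ} → (∀ x → f x ≤ g x) → ∑ xs f ≤ ∑ xs g
∑-mono []       le = z≤n
∑-mono (x ∷ xs) le = +-mono-≤ (le x) (∑-mono xs le)

∑-zero : ∀ (xs : List A) {f : A → ℕ} → (∀ {x} → x ∈ xs → f x ≡ 0) → ∑ xs f ≡ 0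
∑-zero []       eq = refl
∑-zero (x ∷ xs) eq = cong₂ _+_ (eq (here refl)) (∑-zero xs (eq ∘ there))

∑-zero⁻ : ∀ (xs : List A) {f : A → ℕ} → ∑ xs f ≡ 0 → ∀ {x} → x ∈ xs → f x ≡ 0
∑-zero⁻ (x ∷ xs) {f} eq (here refl) = m+n≡0⇒m≡0 (f x) eq
∑-zero⁻ (x ∷ xs) {f} eq (there x∈)  = ∑-zero⁻ xs (m+n≡0⇒n≡0 (f x) eq) x∈

∑-+ : ∀ (xs : List A) f g → ∑ xs (λ x → f x + g x) ≡ ∑ xs f + ∑ xs g
∑-+ []       f g = refl
∑-+ (x ∷ xs) f g = trans (cong (f x + g x +_) (∑-+ xs f g)) (interchange (f x) (g x) _ _)
  where
  interchange : ∀ a b c d → a + b + (c + d) ≡ a + c + (b + d)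
  interchange = solve-∀

∑-*ˡ : ∀ (xs : List A) k f → ∑ xs (λ x → k * f x) ≡ k * ∑ xs f
∑-*ˡ []       k f = sym (*-zeroʳ k)
∑-*ˡ (x ∷ xs) k f = trans (cong (k * f x +_) (∑-*ˡ xs k f)) (sym (*-distribˡ-+ k (f x) _))

∑-*ʳ : ∀ (xs : List A) k f → ∑ xs (λ x → f x * k) ≡ ∑ xs f * k
∑-*ʳ xs k f = trans (∑-cong xs (λ x → *-comm (f x) k)) (trans (∑-*ˡ xs k f) (*-comm k _))

∑-const : ∀ (xs : List A) k → ∑ xs (λ _ → k) ≡ length xs * k
∑-const []       k = refl
∑-const (x ∷ xs) k = cong (k +_) (∑-const xs k)

∑-cartesianProductWith : ∀ (_∙_ : A → B → C) xs ys f →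
  ∑ (cartesianProductWith _∙_ xs ys) f ≡ ∑ xs (λ x → ∑ ys (λ y → f (x ∙ y)))
∑-cartesianProductWith _∙_ []       ys f = refl
∑-cartesianProductWith _∙_ (x ∷ xs) ys f = trans
  (∑-++ (map (x ∙_) ys) _ f)
  (cong₂ _+_ (∑-map (x ∙_) ys f) (∑-cartesianProductWith _∙_ xs ys f))

∑-insert : ∀ (ys zs : List A) x f → ∑ (ys ++ [ x ] ++ zs) f ≡ f x + ∑ (ys ++ zs) f
∑-insert ys zs x f = begin
  ∑ (ys ++ x ∷ zs) f         ≡⟨ ∑-++ ys (x ∷ zs) f ⟩
  ∑ ys f + (f x + ∑ zs f)    ≡⟨ exchange (∑ ys f) (f x) (∑ zs f) ⟩
  f x + (∑ ys f + ∑ zs f)    ≡⟨ cong (f x +_) (∑-++ ys zs f) ⟨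
  f x + ∑ (ys ++ zs) f       ∎
  where
  open ≡-Reasoning
  exchange : ∀ a b c → a + (b + c) ≡ b + (a + c)
  exchange = solve-∀

∈-insert⁻ : ∀ (ys {zs} : List A) {x y} → y ∈ ys ++ [ x ] ++ zs → y ≡ x ⊎ y ∈ ys ++ zs
∈-insert⁻ ys y∈ with ∈-++⁻ ys y∈
... | inj₁ y∈ys         = inj₂ (∈-++⁺ˡ y∈ys)
... | inj₂ (here y≡x)   = inj₁ y≡x
... | inj₂ (there y∈zs) = inj₂ (∈-++⁺ʳ ys y∈zs)

-- Entries of `xs` with `f x ≢ 0` are distinct, so each can strike out an occurrence of its own in
-- `ys`; the others contribute nothing.
∑-support : ∀ {xs : List A} → Unique xs → ∀ ys f →
            (∀ {x} → x ∈ xs → f x ≢ 0 → x ∈ ys) → ∑ xs f ≤ ∑ ys f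
∑-support AllPairs.[] ys f sub = z≤n
∑-support {xs = x ∷ xs} (x≢ AllPairs.∷ u) ys f sub with f x ≟ 0
... | yes fx≡0 = subst (λ k → k + ∑ xs f ≤ ∑ ys f) (sym fx≡0) (∑-support u ys f (sub ∘ there))
... | no  fx≢0 with ∈-∃++ (sub (here refl) fx≢0)
...   | ys₁ , ys₂ , refl = subst (f x + ∑ xs f ≤_) (sym (∑-insert ys₁ ys₂ x f))
  (+-monoʳ-≤ (f x) (∑-support u (ys₁ ++ ys₂) f sub′))
  where
  sub′ : ∀ {z} → z ∈ xs → f z ≢ 0 → z ∈ ys₁ ++ ys₂
  sub′ z∈ fz≢0 with ∈-insert⁻ ys₁ (sub (there z∈) fz≢0)
  ... | inj₁ z≡x = ⊥-elim (All.lookup x≢ z∈ (sym z≡x))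
  ... | inj₂ z∈′ = z∈′

-- Greedy deletion of light fibres.

module Removal {X C : Set} (_≟ˣ_ : DecidableEquality X) (fibre : C → List X) (cost : C → ℕ) where

  open DecMembership _≟ˣ_ using (_∈?_)

  kill : C → (X → ℕ) → X → ℕ
  kill c w x with x ∈? fibre c
  ... | yes _ = 0
  ... | no  _ = w x

  kill-∈ : ∀ c w {x} → x ∈ fibre c → kill c w x ≡ 0
  kill-∈ c w {x} x∈ with x ∈? fibre c
  ... | yes _  = refl
  ... | no  x∉ = ⊥-elim (x∉ x∈)

  kill-∉ : ∀ c w {x} → x ∉ fibre c → kill c w x ≡ w x
  kill-∉ c w {x} x∉ with x ∈? fibre c
  ... | yes x∈ = ⊥-elim (x∉ x∈)
  ... | no  _  = refl

  _⊑_ : (X → ℕ) → (X → ℕ) → Set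
  w′ ⊑ w = ∀ x → w′ x ≡ 0 ⊎ w′ x ≡ w x

  kill-⊑ : ∀ c w → kill c w ⊑ w
  kill-⊑ c w x with x ∈? fibre c
  ... | yes _ = inj₁ refl
  ... | no  _ = inj₂ refl

  ⊑-trans : ∀ {u v w} → u ⊑ v → v ⊑ w → u ⊑ w
  ⊑-trans u⊑v v⊑w x with u⊑v x | v⊑w x
  ... | inj₁ p | _      = inj₁ p
  ... | inj₂ p | inj₁ q = inj₁ (trans p q)
  ... | inj₂ p | inj₂ q = inj₂ (trans p q)

  -- Only an inequality, since a fibre may repeat entries or leave `xs`; `star` below, for instance,
  -- lists `(v , v)` twice.
  kill-loss : ∀ {xs} → Unique xs → ∀ c w → ∑ xs w ≤ ∑ xs (kill c w) + ∑ (fibre c) w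
  kill-loss {xs} u c w = begin
    ∑ xs w                               ≡⟨ ∑-cong xs split ⟩
    ∑ xs (λ x → kill c w x + lost x)     ≡⟨ ∑-+ xs (kill c w) lost ⟩
    ∑ xs (kill c w) + ∑ xs lost          ≤⟨ +-monoʳ-≤ _ (∑-support u (fibre c) lost (λ _ → lost≢0)) ⟩
    ∑ xs (kill c w) + ∑ (fibre c) lost   ≤⟨ +-monoʳ-≤ _ (∑-mono (fibre c) lost≤) ⟩
    ∑ xs (kill c w) + ∑ (fibre c) w      ∎
    where
    open ≤-Reasoning
    lost : X → ℕ
    lost x = w x ∸ kill c w x

    kill≤ : ∀ x → kill c w x ≤ w x
    kill≤ x with kill-⊑ c w x
    ... | inj₁ p = subst (_≤ w x) (sym p) z≤n
    ... | inj₂ p = ≤-reflexive p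

    lost≤ : ∀ x → lost x ≤ w x
    lost≤ x = m∸n≤m (w x) (kill c w x)

    split : ∀ x → w x ≡ kill c w x + lost x
    split x = sym (m+[n∸m]≡n (kill≤ x))

    lost≢0 : ∀ {x} → lost x ≢ 0 → x ∈ fibre c
    lost≢0 {x} l≢0 with x ∈? fibre c
    ... | yes x∈ = x∈
    ... | no  _  = ⊥-elim (l≢0 (n∸n≡0 (w x)))

  Rich : (X → ℕ) → C → Set
  Rich w c = ∑ (fibre c) w ≡ 0 ⊎ cost c < ∑ (fibre c) w

  -- As long as some `c` still listed has a fibre of weight at most its cost, that fibre is killed
  -- and `c` is struck off. Each `c` is charged at most once, whence the loss `∑ cs cost`. `Q` is an
  -- invariant of the deletions, such as symmetry of edge weights.
  clean : ∀ {xs} → Unique xs → (Q : (X → ℕ) → Set) → (∀ c {w} → Q w → Q (kill c w)) →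
          ∀ cs w → Q w →
          ∃[ w′ ] Q w′ × w′ ⊑ w × ∑ xs w ≤ ∑ xs w′ + ∑ cs cost × (∀ {c} → c ∈ cs → Rich w′ c)
  clean {xs} u Q Q-kill cs₀ w₀ q₀ = go (length cs₀) cs₀ refl w₀ q₀
    where
    go : ∀ m cs → length cs ≡ m → ∀ w → Q w →
         ∃[ w′ ] Q w′ × w′ ⊑ w × ∑ xs w ≤ ∑ xs w′ + ∑ cs cost × (∀ {c} → c ∈ cs → Rich w′ c)
    go m cs len w q with any? (λ c → ∑ (fibre c) w ≤? cost c) cs
    ... | no none = w , q , (λ _ → inj₂ refl) , m≤m+n _ _ , λ c∈ → inj₂ (≰⇒> (none ∘ lose c∈))
    ... | yes some with find some
    ...   | c , c∈ , cheap with ∈-∃++ c∈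
    go zero    _ len w q | yes _ | c , c∈ , cheap | cs₁ , cs₂ , refl
      with () ← m+n≡0⇒n≡0 (length cs₁) (trans (sym (length-++ cs₁)) len)
    go (suc m) _ len w q | yes _ | c , c∈ , cheap | cs₁ , cs₂ , refl
      with go m (cs₁ ++ cs₂)
              (suc-injective (trans (sym (trans (length-++ cs₁)
                 (trans (+-suc (length cs₁) _) (cong suc (sym (length-++ cs₁)))))) len))
              (kill c w) (Q-kill c q)
    ... | w′ , q′ , w′⊑ , bound , rich =
      w′ , q′ , ⊑-trans w′⊑ (kill-⊑ c w) , bound′ , rich′
      where
      open ≤-Reasoning
      exchange : ∀ a b c → a + b + c ≡ a + (c + b)
      exchange = solve-∀

      bound′ : ∑ xs w ≤ ∑ xs w′ + ∑ (cs₁ ++ [ c ] ++ cs₂) cost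
      bound′ = begin
        ∑ xs w                                    ≤⟨ kill-loss u c w ⟩
        ∑ xs (kill c w) + ∑ (fibre c) w           ≤⟨ +-mono-≤ bound cheap ⟩
        ∑ xs w′ + ∑ (cs₁ ++ cs₂) cost + cost c    ≡⟨ exchange (∑ xs w′) (∑ (cs₁ ++ cs₂) cost) (cost c) ⟩
        ∑ xs w′ + (cost c + ∑ (cs₁ ++ cs₂) cost)  ≡⟨ cong (∑ xs w′ +_) (∑-insert cs₁ cs₂ c cost) ⟨
        ∑ xs w′ + ∑ (cs₁ ++ [ c ] ++ cs₂) cost    ∎

      rich′ : ∀ {d} → d ∈ cs₁ ++ [ c ] ++ cs₂ → Rich w′ d
      rich′ d∈ with ∈-insert⁻ cs₁ d∈
      ... | inj₂ d∈′  = rich d∈′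
      -- Later deletions only erase weights, so the fibre of the struck-off `c` stays at zero.
      ... | inj₁ refl = inj₁ (∑-zero (fibre c) λ {x} x∈ → dead (w′⊑ x) (kill-∈ c w x∈))
        where
        dead : ∀ {a b} → a ≡ 0 ⊎ a ≡ b → b ≡ 0 → a ≡ 0
        dead (inj₁ p) _ = p
        dead (inj₂ p) q = trans p q

-- Words, and words with one vertex left open.

words : ∀ {n} → ℕ → List (List (Fin n))
words zero    = [ [] ]
words (suc k) = cartesianProductWith _∷_ (allFin _) (words k)

words-unique : ∀ {n} k → Unique (words {n} k)
words-unique zero    = All.[] AllPairs.∷ AllPairs.[]
words-unique (suc k) =
  Unique.cartesianProductWith⁺ _∷_ ∷-injective (Unique.allFin⁺ _) (words-unique k)

∈-words : ∀ {n} (xs : List (Fin n)) → xs ∈ words (length xs)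
∈-words []       = here refl
∈-words (x ∷ xs) = ∈-cartesianProductWith⁺ _∷_ (∈-allFin x) (∈-words xs)

∈-words⁻ : ∀ {n} k {w : List (Fin n)} → w ∈ words k → length w ≡ k
∈-words⁻ zero    (here refl) = refl
∈-words⁻ (suc k) w∈ with ∈-cartesianProductWith⁻ _∷_ (allFin _) (words k) w∈
... | _ , _ , _ , ys∈ , refl = cong suc (∈-words⁻ k ys∈)

∈-words′ : ∀ {n k} (xs : List (Fin n)) → length xs ≡ k → xs ∈ words k
∈-words′ xs refl = ∈-words xs

-- (l , r) stands for the words l ʳ++ v ∷ r, in which only v varies; contexts i k
-- lists all pairs with lengths i + 1 + d and k - d for 0 ≤ d < k.
contexts : ∀ {n} → ℕ → ℕ → List (List (Fin n) × List (Fin n))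
contexts i zero    = []
contexts i (suc k) = cartesianProduct (words (suc i)) (words (suc k)) ++ contexts (suc i) k

∈-contexts : ∀ {n} d i k (x : Fin n) l y r → length l ≡ i + d → d + suc (length r) ≡ k →
             (x ∷ l , y ∷ r) ∈ contexts i k
∈-contexts zero    i _ x l y r len  refl = ∈-++⁺ˡ
  (∈-cartesianProduct⁺ (∈-words′ (x ∷ l) (cong suc (trans len (+-identityʳ i)))) (∈-words (y ∷ r)))
∈-contexts (suc d) i _ x l y r len  refl = ∈-++⁺ʳ (cartesianProduct (words (suc i)) _)
  (∈-contexts d (suc i) _ x l y r (trans len (+-suc i d)) refl)

-- The total weight of walks.

∑-bounded : ∀ {n} (f : Fin n → ℕ) b → (∀ v → f v ≤ b) → ∑ (allFin n) f ≤ n * b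
∑-bounded {n} f b f≤b = begin
  ∑ (allFin n) f           ≤⟨ ∑-mono (allFin n) f≤b ⟩
  ∑ (allFin n) (λ _ → b)   ≡⟨ ∑-const (allFin n) b ⟩
  length (allFin n) * b    ≡⟨ cong (_* b) (length-tabulate {n = n} id) ⟩
  n * b                    ∎
  where open ≤-Reasoning

-- q v is 1 / deg v cleared of denominators; isolated vertices lie on no walk of
-- positive length, so their q is arbitrary.
module Walks {n : ℕ} (a : Fin n → Fin n → ℕ)
  (a≤1 : ∀ u v → a u v ≤ 1) (a-sym : ∀ u v → a u v ≡ a v u)
  (q : Fin n → ℕ) (M Q : ℕ) (q≤Q : ∀ v → q v ≤ Q)
  (q-deg : ∀ v → ∑ (allFin n) (a v) ≢ 0 → q v * ∑ (allFin n) (a v) ≡ M)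
  where

  private
    V : Set
    V = Fin n

    vs : List V
    vs = allFin n

  deg : V → ℕ
  deg v = ∑ vs (a v)

  -- weight₁ charges q for all vertices but the last, weight only for the interior ones.
  weight₁ : List V → ℕ
  weight₁ []           = 1
  weight₁ (_ ∷ [])     = 1
  weight₁ (x ∷ y ∷ ys) = q x * a x y * weight₁ (y ∷ ys)

  weight : List V → ℕ
  weight []           = 0
  weight (_ ∷ [])     = 0
  weight (x ∷ y ∷ ys) = a x y * weight₁ (y ∷ ys)

  -- Cutting at the edge `x y` leaves two walks leading away from it; `a-sym` lets the left one be
  -- read backwards. Their last vertices are the ends of the whole walk, which is why `weight₁`
  -- charges nothing for them.
  weight-join : ∀ x l y r → weight ((x ∷ l) ʳ++ y ∷ r) ≡ a x y * (weight₁ (x ∷ l) * weight₁ (y ∷ r))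
  weight-join x []       y r = cong (a x y *_) (sym (+-identityʳ _))
  weight-join x (z ∷ l)  y r = begin
    weight ((z ∷ l) ʳ++ x ∷ y ∷ r)
      ≡⟨ weight-join z l x (y ∷ r) ⟩
    a z x * (weight₁ (z ∷ l) * (q x * a x y * weight₁ (y ∷ r)))
      ≡⟨ cong (_* (weight₁ (z ∷ l) * (q x * a x y * weight₁ (y ∷ r)))) (a-sym z x) ⟩
    a x z * (weight₁ (z ∷ l) * (q x * a x y * weight₁ (y ∷ r)))
      ≡⟨ rearrange (a x z) (weight₁ (z ∷ l)) (q x) (a x y) (weight₁ (y ∷ r)) ⟩
    a x y * (q x * a x z * weight₁ (z ∷ l) * weight₁ (y ∷ r)) ∎
    where
    open ≡-Reasoning
    rearrange : ∀ a b c d e → a * (b * (c * d * e)) ≡ d * (c * a * b * e)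
    rearrange = solve-∀

  -- Bounds one member of a fibre by its context alone, so that a heavy fibre must have many
  -- members.
  weight-interior : ∀ x l v y r →
    weight ((x ∷ l) ʳ++ v ∷ y ∷ r) ≤ Q * (weight₁ (x ∷ l) * weight₁ (y ∷ r))
  weight-interior x l v y r = begin
    weight ((x ∷ l) ʳ++ v ∷ y ∷ r)      ≡⟨ weight-join x l v (y ∷ r) ⟩
    a x v * (L * (q v * a v y * R))     ≤⟨ *-mono-≤ (a≤1 x v) (*-monoʳ-≤ L
                                             (*-monoˡ-≤ R (*-mono-≤ (q≤Q v) (a≤1 v y)))) ⟩
    1 * (L * (Q * 1 * R))               ≡⟨ rearrange L Q R ⟩
    Q * (L * R)                         ∎
    where
    open ≤-Reasoning
    L = weight₁ (x ∷ l)
    R = weight₁ (y ∷ r)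
    rearrange : ∀ l q r → 1 * (l * (q * 1 * r)) ≡ q * (l * r)
    rearrange = solve-∀

  walksFrom : ℕ → V → ℕ
  walksFrom k x = ∑ (words k) (λ ys → weight₁ (x ∷ ys))

  walksFrom-suc : ∀ k x → walksFrom (suc k) x ≡ q x * ∑ vs (λ y → a x y * walksFrom k y)
  walksFrom-suc k x = begin
    walksFrom (suc k) x
      ≡⟨ ∑-cartesianProductWith _∷_ vs (words k) (λ ys → weight₁ (x ∷ ys)) ⟩
    ∑ vs (λ y → ∑ (words k) (λ ys → q x * a x y * weight₁ (y ∷ ys)))
      ≡⟨ ∑-cong vs (λ y → trans (∑-*ˡ (words k) (q x * a x y) _) (*-assoc (q x) (a x y) _)) ⟩
    ∑ vs (λ y → q x * (a x y * walksFrom k y))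
      ≡⟨ ∑-*ˡ vs (q x) _ ⟩
    q x * ∑ vs (λ y → a x y * walksFrom k y) ∎
    where open ≡-Reasoning

  deg≢0 : ∀ {x y} → a x y ≢ 0 → deg y ≢ 0
  deg≢0 {x} {y} axy≢0 deg≡0 = axy≢0 (trans (a-sym x y) (∑-zero⁻ vs deg≡0 (∈-allFin x)))

  -- Knowing the non-isolated `y` is enough, because `a x y ≢ 0` gives `y` the neighbour `x`.
  neighbours : ∀ k x → (∀ y → deg y ≢ 0 → walksFrom k y ≡ M ^ k) →
               ∑ vs (λ y → a x y * walksFrom k y) ≡ deg x * M ^ k
  neighbours k x eq = trans (∑-cong vs step) (∑-*ʳ vs (M ^ k) (a x))
    where
    step : ∀ y → a x y * walksFrom k y ≡ a x y * M ^ k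
    step y with a x y ≟ 0
    ... | yes p rewrite p = refl
    ... | no ¬p           = cong (a x y *_) (eq y (deg≢0 ¬p))

  -- Simple random walk: since `q x * deg x ≡ M`, the factors `q x * a x y` are `M` times transition
  -- probabilities, which sum to 1 at each of the `k` steps.
  walksFrom-≡ : ∀ k x → deg x ≢ 0 → walksFrom k x ≡ M ^ k
  walksFrom-≡ zero    x _     = refl
  walksFrom-≡ (suc k) x deg≢0 = begin
    walksFrom (suc k) x                          ≡⟨ walksFrom-suc k x ⟩
    q x * ∑ vs (λ y → a x y * walksFrom k y)     ≡⟨ cong (q x *_) (neighbours k x (walksFrom-≡ k)) ⟩
    q x * (deg x * M ^ k)                        ≡⟨ *-assoc (q x) (deg x) (M ^ k) ⟨
    q x * deg x * M ^ k                          ≡⟨ cong (_* M ^ k) (q-deg x deg≢0) ⟩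
    M * M ^ k                                    ∎
    where open ≡-Reasoning

  walksFrom-≤ : ∀ k x → walksFrom k x ≤ M ^ k
  walksFrom-≤ zero    x = ≤-refl
  walksFrom-≤ (suc k) x with deg x ≟ 0
  ... | no  deg≢0 = ≤-reflexive (walksFrom-≡ (suc k) x deg≢0)
  ... | yes deg≡0 = subst (_≤ M ^ suc k) (sym isolated) z≤n
    where
    isolated : walksFrom (suc k) x ≡ 0
    isolated = trans (walksFrom-suc k x) (trans (cong (q x *_) (neighbours k x (walksFrom-≡ k)))
                 (trans (cong (λ d → q x * (d * M ^ k)) deg≡0) (*-zeroʳ (q x))))

  -- The first vertex carries no factor `q`, so each ordered adjacent pair is followed by `k` steps
  -- of random walk, of total weight `M ^ k`.
  ∑-weight : ∀ k → ∑ (words (suc (suc k))) weight ≡ ∑ vs deg * M ^ k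
  ∑-weight k = begin
    ∑ (words (suc (suc k))) weight
      ≡⟨ ∑-cartesianProductWith _∷_ vs (words (suc k)) weight ⟩
    ∑ vs (λ x → ∑ (words (suc k)) (λ ys → weight (x ∷ ys)))
      ≡⟨ ∑-cong vs (λ x → ∑-cartesianProductWith _∷_ vs (words k) (λ ys → weight (x ∷ ys))) ⟩
    ∑ vs (λ x → ∑ vs (λ y → ∑ (words k) (λ ys → a x y * weight₁ (y ∷ ys))))
      ≡⟨ ∑-cong vs (λ x → ∑-cong vs (λ y → ∑-*ˡ (words k) (a x y) _)) ⟩
    ∑ vs (λ x → ∑ vs (λ y → a x y * walksFrom k y))
      ≡⟨ ∑-cong vs (λ x → neighbours k x (walksFrom-≡ k)) ⟩
    ∑ vs (λ x → deg x * M ^ k)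
      ≡⟨ ∑-*ʳ vs (M ^ k) deg ⟩
    ∑ vs deg * M ^ k ∎
    where open ≡-Reasoning

  ∑-weight₁ : ∀ k → ∑ (words (suc k)) weight₁ ≤ n * M ^ k
  ∑-weight₁ k = begin
    ∑ (words (suc k)) weight₁   ≡⟨ ∑-cartesianProductWith _∷_ vs (words k) weight₁ ⟩
    ∑ vs (walksFrom k)          ≤⟨ ∑-bounded (walksFrom k) (M ^ k) (walksFrom-≤ k) ⟩
    n * M ^ k                   ∎
    where open ≤-Reasoning

  -- Deletion of walks with too few replacements.

  fibre : List V × List V → List (List V)
  fibre (l , r) = map (λ v → l ʳ++ v ∷ r) vs

  module Replacement (s : ℕ) where

    -- This is `s` times the bound of `weight-interior`: a fibre that weighs more has more than `s`
    -- members of nonzero weight.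
    cost : List V × List V → ℕ
    cost (l , r) = s * Q * (weight₁ l * weight₁ r)

    ∑-cost-product : ∀ i k →
      ∑ (cartesianProduct (words (suc i)) (words (suc k))) cost ≤ s * Q * (n * n) * M ^ (i + k)
    ∑-cost-product i k = begin
      ∑ (cartesianProduct ls rs) cost
        ≡⟨ ∑-cartesianProductWith _,_ ls rs cost ⟩
      ∑ ls (λ l → ∑ rs (λ r → s * Q * (weight₁ l * weight₁ r)))
        ≡⟨ ∑-cong ls (λ l → trans (∑-*ˡ rs (s * Q) (λ r → weight₁ l * weight₁ r))
             (cong (s * Q *_) (∑-*ˡ rs (weight₁ l) weight₁))) ⟩
      ∑ ls (λ l → s * Q * (weight₁ l * ∑ rs weight₁))
        ≡⟨ trans (∑-*ˡ ls (s * Q) (λ l → weight₁ l * ∑ rs weight₁))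
             (cong (s * Q *_) (∑-*ʳ ls (∑ rs weight₁) weight₁)) ⟩
      s * Q * (∑ ls weight₁ * ∑ rs weight₁)
        ≤⟨ *-monoʳ-≤ (s * Q) (*-mono-≤ (∑-weight₁ i) (∑-weight₁ k)) ⟩
      s * Q * (n * M ^ i * (n * M ^ k))
        ≡⟨ rearrange (s * Q) n (M ^ i) (M ^ k) ⟩
      s * Q * (n * n) * (M ^ i * M ^ k)
        ≡⟨ cong (s * Q * (n * n) *_) (^-distribˡ-+-* M i k) ⟨
      s * Q * (n * n) * M ^ (i + k) ∎
      where
      open ≤-Reasoning
      ls = words {n} (suc i)
      rs = words {n} (suc k)
      rearrange : ∀ c n x y → c * (n * x * (n * y)) ≡ c * (n * n) * (x * y)
      rearrange = solve-∀

    -- There are `k` open positions. At each, the two parts have `p + 2` vertices in all, and each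
    -- part gives up one vertex to a factor `n`, so `M ^ p` remains.
    ∑-cost : ∀ p i k → i + k ≡ suc p → ∑ (contexts i k) cost ≤ k * (s * Q * (n * n) * M ^ p)
    ∑-cost p i zero    eq = z≤n
    ∑-cost p i (suc k) eq = begin
      ∑ (contexts i (suc k)) cost
        ≡⟨ ∑-++ (cartesianProduct (words (suc i)) (words (suc k))) (contexts (suc i) k) cost ⟩
      ∑ (cartesianProduct (words (suc i)) (words (suc k))) cost + ∑ (contexts (suc i) k) cost
        ≤⟨ +-mono-≤ (∑-cost-product i k) (∑-cost p (suc i) k (trans (sym (+-suc i k)) eq)) ⟩
      s * Q * (n * n) * M ^ (i + k) + k * K
        ≡⟨ cong (λ e → s * Q * (n * n) * M ^ e + k * K) (suc-injective (trans (sym (+-suc i k)) eq)) ⟩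
      K + k * K ∎
      where
      open ≤-Reasoning
      K = s * Q * (n * n) * M ^ p

    open Removal (≡-dec (Fin._≟_ {n})) fibre cost
    open DecMembership (Fin._≟_ {n}) using (_∈?_)

    -- The deletions cost less than the total weight, so a walk survives. A fibre through a survivor
    -- is nonzero, hence rich, hence has more than `s` survivors, one of which avoids `S`.
    flexible-words : ∀ p → suc p * (s * Q * (n * n) * M ^ p) < ∑ vs deg * M ^ suc p →
      ∃[ Good ]
        (∃[ w ] Good w × length w ≡ 3 + p) ×
        (∀ x l y r → Good ((x ∷ l) ʳ++ y ∷ r) → a x y ≢ 0) ×
        (∀ x l v y r → Good ((x ∷ l) ʳ++ v ∷ y ∷ r) → ∀ S → length S ≤ s →
          ∃[ v′ ] v′ ∉ S × Good ((x ∷ l) ʳ++ v′ ∷ y ∷ r))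
    flexible-words p cheap
      with clean (words-unique (3 + p)) (λ _ → ⊤) (λ _ _ → tt)
                 (contexts 0 (suc p)) weight tt
    ... | w′ , _ , w′⊑ , bound , rich = Good , start , adjacent , replace
      where
      -- The length is recorded because only the contexts of words of this length have been cleaned.
      Good : List V → Set
      Good w = w′ w ≢ 0 × length w ≡ 3 + p

      start : ∃[ w ] Good w × length w ≡ 3 + p
      start with any? (λ w → ¬? (w′ w ≟ 0) ×-dec (length w ≟ 3 + p)) (words (3 + p))
      ... | yes some = let w , _ , good = find some in w , good , proj₂ good
      ... | no none  = ⊥-elim (<⇒≱ cheap (begin
        ∑ vs deg * M ^ suc p
          ≡⟨ ∑-weight (suc p) ⟨
        ∑ (words {n} (3 + p)) weight
          ≤⟨ bound ⟩
        ∑ (words (3 + p)) w′ + ∑ (contexts 0 (suc p)) cost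
          ≡⟨ cong (_+ ∑ (contexts 0 (suc p)) cost) (∑-zero (words (3 + p)) dead) ⟩
        ∑ (contexts 0 (suc p)) cost
          ≤⟨ ∑-cost p 0 (suc p) refl ⟩
        suc p * (s * Q * (n * n) * M ^ p) ∎))
        where
        open ≤-Reasoning
        dead : ∀ {w} → w ∈ words (3 + p) → w′ w ≡ 0
        dead {w} w∈ = decidable-stable (w′ w ≟ 0) λ ≢0 → none (lose w∈ (≢0 , ∈-words⁻ _ w∈))

      ⊑-≢0 : ∀ {w} → w′ w ≢ 0 → weight w ≢ 0
      ⊑-≢0 {w} ≢0 with w′⊑ w
      ... | inj₁ p = ⊥-elim (≢0 p)
      ... | inj₂ p = ≢0 ∘ trans p

      adjacent : ∀ x l y r → Good ((x ∷ l) ʳ++ y ∷ r) → a x y ≢ 0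
      adjacent x l y r (≢0 , _) a≡0 =
        ⊑-≢0 ≢0 (trans (weight-join x l y r) (cong (_* (weight₁ (x ∷ l) * weight₁ (y ∷ r))) a≡0))

      replace : ∀ x l v y r → Good ((x ∷ l) ʳ++ v ∷ y ∷ r) → ∀ S → length S ≤ s →
                ∃[ v′ ] v′ ∉ S × Good ((x ∷ l) ʳ++ v′ ∷ y ∷ r)
      replace x l v y r (≢0 , len) S |S|≤s
        with any? (λ z → ¬? (z ∈? S) ×-dec ¬? (w′ (at z) ≟ 0)) vs
        where
        at : V → List V
        at z = (x ∷ l) ʳ++ z ∷ y ∷ r
      ... | yes some = let z , _ , z∉S , ≢0′ = find some in
        z , z∉S , ≢0′ ,
        trans (length-ʳ++ l {x ∷ z ∷ y ∷ r}) (trans (sym (length-ʳ++ l {x ∷ v ∷ y ∷ r})) len)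
      ... | no none with rich c∈
        where
        len′ : length l + suc (length r) ≡ suc p
        len′ = suc-injective (suc-injective (trans (sym (trans (length-ʳ++ l {x ∷ v ∷ y ∷ r})
                 (trans (+-suc (length l) _) (cong suc (+-suc (length l) _))))) len))
        c∈ : (x ∷ l , y ∷ r) ∈ contexts 0 (suc p)
        c∈ = ∈-contexts (length l) 0 (suc p) x l y r refl len′
      ...   | inj₁ empty = ⊥-elim (≢0 (∑-zero⁻ (fibre (x ∷ l , y ∷ r)) empty
                             (∈-map⁺ (λ z → (x ∷ l) ʳ++ z ∷ y ∷ r) (∈-allFin v))))
      -- If all survivors of the fibre had their open vertex in `S`, they would weigh at most `s`
      -- times the bound on one of them, which is the cost.
      ...   | inj₂ big   = ⊥-elim (<⇒≱ big (begin
        ∑ (fibre (x ∷ l , y ∷ r)) w′                     ≡⟨ ∑-map at vs w′ ⟩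
        ∑ vs (w′ ∘ at)                                   ≤⟨ ∑-support (Unique.allFin⁺ n) S (w′ ∘ at) inS ⟩
        ∑ S (w′ ∘ at)                                    ≤⟨ ∑-mono S w′≤ ⟩
        ∑ S (λ _ → Q * LR)                               ≡⟨ ∑-const S (Q * LR) ⟩
        length S * (Q * LR)                              ≤⟨ *-monoˡ-≤ (Q * LR) |S|≤s ⟩
        s * (Q * LR)                                     ≡⟨ *-assoc s Q LR ⟨
        s * Q * LR                                       ∎))
        where
        open ≤-Reasoning
        LR = weight₁ (x ∷ l) * weight₁ (y ∷ r)

        at : V → List V
        at z = (x ∷ l) ʳ++ z ∷ y ∷ r

        inS : ∀ {z} → z ∈ vs → w′ (at z) ≢ 0 → z ∈ S
        inS {z} z∈ ≢0′ = decidable-stable (z ∈? S) λ z∉ → none (lose z∈ (z∉ , ≢0′))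

        w′≤ : ∀ z → w′ (at z) ≤ Q * LR
        w′≤ z with w′⊑ (at z)
        ... | inj₁ p = subst (_≤ Q * LR) (sym p) z≤n
        ... | inj₂ p = subst (_≤ Q * LR) (sym p) (weight-interior x l z y r)

-- Sweeping out a grid.

+-exchange : ∀ a b c → a + b + c ≡ b + (a + c)
+-exchange = solve-∀

module Sweep {V : Set} (_∼_ : V → V → Set) (Good : List V → Set) (s : ℕ)
  (adjacent : ∀ x l y r → Good ((x ∷ l) ʳ++ y ∷ r) → x ∼ y)
  (replace : ∀ x l v y r → Good ((x ∷ l) ʳ++ v ∷ y ∷ r) → ∀ S → length S ≤ s →
    ∃[ v′ ] v′ ∉ S × Good ((x ∷ l) ʳ++ v′ ∷ y ∷ r))
  where

  -- Row cells are filled from left to right; the new row ends up one position to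
  -- the left of the old one, whose last vertex z is pushed into B.
  sweep-row : ∀ {k} x l v (row : Fin k → V) B (S : List V) → length S + k ≤ suc s →
    Good ((x ∷ l) ʳ++ v ∷ tabulate row ++ B) →
    Σ[ new ∈ (Fin k → V) ] ∃[ z ] Good ((x ∷ l) ʳ++ tabulate new ++ z ∷ B)
      × (∀ j → new j ∉ S)
      × (∀ {j j′} → new j ≡ new j′ → j ≡ j′)
      × (∀ j → new j ∼ row j)
      × (∀ {j j′} → toℕ j′ ≡ suc (toℕ j) → new j ∼ new j′)
      × (∀ j → toℕ j ≡ 0 → x ∼ new j)
  sweep-row {zero} x l v row B S _ good =
    (λ ()) , v , good , (λ ()) , (λ { {()} }) , (λ ()) , (λ { {()} }) , (λ ())
  sweep-row {suc k} x l v row B S room good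
    with y , y∉S , good₁ ← replace x l v (row zero) _ good S
                             (m+n≤o⇒m≤o (length S) (s≤s⁻¹ (subst (_≤ suc s) (+-suc (length S) k) room)))
    with new , z , good₂ , new∉ , new-inj , new∼row , new∼new , y∼new ←
      sweep-row y (x ∷ l) (row zero) (row ∘ suc) B (y ∷ S)
        (subst (_≤ suc s) (+-suc (length S) k) room) good₁
    = y Vector.∷ new , z , good₂ , ∉S , injective , ∼row , ∼next , x∼first
    where
    ∉S : ∀ j → (y Vector.∷ new) j ∉ S
    ∉S zero    = y∉S
    ∉S (suc j) = new∉ j ∘ there

    injective : ∀ {j j′} → (y Vector.∷ new) j ≡ (y Vector.∷ new) j′ → j ≡ j′
    injective {zero}  {zero}   _  = refl
    injective {zero}  {suc j′} eq = ⊥-elim (new∉ j′ (here (sym eq)))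
    injective {suc j} {zero}   eq = ⊥-elim (new∉ j (here eq))
    injective {suc j} {suc j′} eq = cong suc (new-inj eq)

    ∼row : ∀ j → (y Vector.∷ new) j ∼ row j
    ∼row zero    = adjacent y (x ∷ l) (row zero) _ good₁
    ∼row (suc j) = new∼row j

    ∼next : ∀ {j j′} → toℕ j′ ≡ suc (toℕ j) → (y Vector.∷ new) j ∼ (y Vector.∷ new) j′
    ∼next {zero}  {suc j′} eq = y∼new j′ (suc-injective eq)
    ∼next {suc j} {suc j′} eq = new∼new (suc-injective eq)

    x∼first : ∀ j → toℕ j ≡ 0 → x ∼ (y Vector.∷ new) j
    x∼first zero _ = adjacent x l y _ good₁

  -- Each row uses up the first vertex of `l`, and the last one, an end of the walk, is never
  -- exchanged; hence the length `suc h`. Finished rows join `S`, which gives injectivity across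
  -- rows. The room is `suc s` because a vertex being chosen is not yet in the set to avoid. The
  -- last conclusion links the first new row to the row above it.
  sweep : ∀ {h t} l (row : Fin t → V) B (S : List V) → length l ≡ suc h → length S + h * t ≤ suc s →
    Good (l ʳ++ tabulate row ++ B) →
    Σ[ φ ∈ (Fin h → Fin t → V) ] (∀ i j → φ i j ∉ S)
      × (∀ {i j i′ j′} → φ i j ≡ φ i′ j′ → (i , j) ≡ (i′ , j′))
      × (∀ i {j j′} → toℕ j′ ≡ suc (toℕ j) → φ i j ∼ φ i j′)
      × (∀ {i i′} j → toℕ i′ ≡ suc (toℕ i) → φ i′ j ∼ φ i j)
      × (∀ i j → toℕ i ≡ 0 → φ i j ∼ row j)
  sweep {zero} l row B S _ _ good = (λ ()) , (λ ()) , (λ { {()} }) , (λ ()) , (λ { {()} }) , (λ ())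
  sweep {suc h} {t} (v ∷ x ∷ l) row B S len room good
    with new , z , good₁ , new∉ , new-inj , new∼row , new∼new , _ ←
      sweep-row x l v row B S
        (≤-trans (+-monoʳ-≤ (length S) (m≤m+n t (h * t))) room) good
    with φ , φ∉ , φ-inj , φ-across , φ-down , φ-top ←
      sweep (x ∷ l) new (z ∷ B) (tabulate new ++ S) (suc-injective len)
        (subst (_≤ suc s) (sym (trans (cong (_+ h * t) (trans (length-++ (tabulate new))
           (cong (_+ length S) (length-tabulate new)))) (+-exchange t (length S) (h * t)))) room) good₁
    = new Vector.∷ φ , ∉S , injective , across , down , (λ { zero j _ → new∼row j })
    where
    clash : ∀ {i j j′} → φ i j ≢ new j′
    clash {i} {j} {j′} eq = φ∉ i j (∈-++⁺ˡ (subst (_∈ tabulate new) (sym eq) (∈-tabulate⁺ j′)))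

    ∉S : ∀ i j → (new Vector.∷ φ) i j ∉ S
    ∉S zero    j = new∉ j
    ∉S (suc i) j = φ∉ i j ∘ ∈-++⁺ʳ (tabulate new)

    injective : ∀ {i j i′ j′} → (new Vector.∷ φ) i j ≡ (new Vector.∷ φ) i′ j′ → (i , j) ≡ (i′ , j′)
    injective {zero}  {_} {zero}   eq = cong (zero ,_) (new-inj eq)
    injective {zero}  {_} {suc i′} eq = ⊥-elim (clash (sym eq))
    injective {suc i} {_} {zero}   eq = ⊥-elim (clash eq)
    injective {suc i} {_} {suc i′} eq with refl ← φ-inj eq = refl

    across : ∀ i {j j′} → toℕ j′ ≡ suc (toℕ j) → (new Vector.∷ φ) i j ∼ (new Vector.∷ φ) i j′
    across zero    = new∼new
    across (suc i) = φ-across i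

    down : ∀ {i i′} j → toℕ i′ ≡ suc (toℕ i) → (new Vector.∷ φ) i′ j ∼ (new Vector.∷ φ) i j
    down {zero}  {suc i′} j eq = φ-top i′ j (suc-injective eq)
    down {suc i} {suc i′} j eq = φ-down j (suc-injective eq)

-- Auxiliary facts on lists and numbers.

split-ʳ++ : ∀ {A : Set} k acc (w : List A) {m} → length w ≡ k + m →
  ∃[ l ] ∃[ r ] acc ʳ++ w ≡ l ʳ++ r × length l ≡ k + length acc × length r ≡ m
split-ʳ++ zero    acc w       len = acc , w , refl , refl , len
split-ʳ++ (suc k) acc (x ∷ w) len
  with l , r , eq , |l| , |r| ← split-ʳ++ k (x ∷ acc) w (suc-injective len)
  = l , r , eq , trans |l| (+-suc k (length acc)) , |r|

as-tabulate : ∀ {A : Set} (r : List A) {m} → length r ≡ m → ∃[ f ] r ≡ tabulate {n = m} f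
as-tabulate r refl = lookup r , sym (tabulate-lookup r)

distance-1 : ∀ m n → ∣ m - n ∣ ≡ 1 → n ≡ suc m ⊎ m ≡ suc n
distance-1 zero    n       eq = inj₁ eq
distance-1 (suc m) zero    eq = inj₂ eq
distance-1 (suc m) (suc n) eq with distance-1 m n eq
... | inj₁ p = inj₁ (cong suc p)
... | inj₂ p = inj₂ (cong suc p)

length-filter-≤ : ∀ {A : Set} {P : A → Set} (P? : ∀ x → Dec (P x)) (f : A → ℕ) →
  (∀ {x} → P x → 1 ≤ f x) → ∀ xs → length (filter P? xs) ≤ ∑ xs f
length-filter-≤ P? f 1≤f []       = z≤n
length-filter-≤ P? f 1≤f (x ∷ xs) with P? x
... | yes p = +-mono-≤ (1≤f p) (length-filter-≤ P? f 1≤f xs)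
... | no  _ = m≤n⇒m≤o+n (f x) (length-filter-≤ P? f 1≤f xs)

-- Makes `n !` a common denominator for the reciprocals of all nonzero degrees.
m∣n! : ∀ {m n} → m ≢ 0 → m ≤ n → m ∣ n !
m∣n! {zero}  m≢0 _   = ⊥-elim (m≢0 refl)
m∣n! {suc m} _   m≤n = ∣-trans (m∣m*n (m !)) (m≤n⇒m!∣n! m≤n)

-- Pruning a graph to high degrees.

module _ {n} (G : Graph (Fin n)) where
  open Graph G

  private
    V : Set
    V = Fin n

    vs : List V
    vs = allFin n

    pairs : List (V × V)
    pairs = cartesianProduct vs vs

  adjacency : V × V → ℕ
  adjacency (u , v) with u ~? v
  ... | yes _ = 1
  ... | no  _ = 0

  adjacency⁺ : ∀ {u v} → u ~ v → adjacency (u , v) ≡ 1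
  adjacency⁺ {u} {v} u~v with u ~? v
  ... | yes _   = refl
  ... | no  u≁v = ⊥-elim (u≁v u~v)

  adjacency⁻ : ∀ {u v} → adjacency (u , v) ≢ 0 → u ~ v
  adjacency⁻ {u} {v} ≢0 with u ~? v
  ... | yes u~v = u~v
  ... | no  _   = ⊥-elim (≢0 refl)

  adjacency-≤1 : ∀ x → adjacency x ≤ 1
  adjacency-≤1 (u , v) with u ~? v
  ... | yes _ = ≤-refl
  ... | no  _ = z≤n

  adjacency-sym : ∀ u v → adjacency (u , v) ≡ adjacency (v , u)
  adjacency-sym u v with u ~? v
  ... | yes u~v = sym (adjacency⁺ (~-sym u~v))
  ... | no  u≁v with v ~? u
  ...   | yes v~u = ⊥-elim (u≁v (~-sym v~u))
  ...   | no  _   = refl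

  -- Every edge occurs in `pairs` in both orders, so a factor 2 is given away here.
  edgeCount-≤ : edgeCount G ≤ ∑ pairs adjacency
  edgeCount-≤ = length-filter-≤ _ adjacency
    (λ (_ , u~v) → ≤-reflexive (sym (adjacency⁺ u~v))) pairs

  -- Both orders are listed so that deleting a star keeps the weights symmetric.
  star : V → List (V × V)
  star v = map (v ,_) vs ++ map (_, v) vs

  star-swap : ∀ {c u v} → (u , v) ∈ star c → (v , u) ∈ star c
  star-swap {c} {u} {v} uv∈ with ∈-++⁻ (map (c ,_) vs) uv∈
  ... | inj₁ uv∈₁ with _ , _ , refl ← ∈-map⁻ (c ,_) uv∈₁ =
    ∈-++⁺ʳ (map (c ,_) vs) (∈-map⁺ (_, c) (∈-allFin v))
  ... | inj₂ uv∈₂ with _ , _ , refl ← ∈-map⁻ (_, c) uv∈₂ =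
    ∈-++⁺ˡ (∈-map⁺ (c ,_) (∈-allFin u))

  module _ (δ : ℕ) where

    open Removal (Product.≡-dec (Fin._≟_ {n}) Fin._≟_) star (λ _ → δ + δ)
    open DecMembership (Product.≡-dec (Fin._≟_ {n}) (Fin._≟_ {n})) using (_∈?_)

    SymmetricWeight : (V × V → ℕ) → Set
    SymmetricWeight w = ∀ u v → w (u , v) ≡ w (v , u)

    kill-sym : ∀ c {w} → SymmetricWeight w → SymmetricWeight (kill c w)
    kill-sym c {w} w-sym u v with (u , v) ∈? star c
    ... | yes uv∈ = sym (kill-∈ c w (star-swap uv∈))
    ... | no  uv∉ = trans (w-sym u v) (sym (kill-∉ c w (uv∉ ∘ star-swap)))

    -- With both orders counted, the star of `v` weighs twice the degree of `v`; hence the cost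
    -- `δ + δ`, paid for at most `n` stars.
    high-degrees : ∃[ a ] (∀ u v → a u v ≡ a v u) × (∀ u v → a u v ≤ 1)
      × (∀ u v → a u v ≢ 0 → u ~ v)
      × ∑ pairs adjacency ≤ ∑ vs (λ v → ∑ vs (a v)) + n * (δ + δ)
      × (∀ v → ∑ vs (a v) ≢ 0 → δ < ∑ vs (a v))
    high-degrees
      with w , w-sym , w⊑ , bound , rich ←
        clean (Unique.cartesianProduct⁺ (Unique.allFin⁺ n) (Unique.allFin⁺ n))
              SymmetricWeight kill-sym vs adjacency adjacency-sym
      = (λ u v → w (u , v)) , w-sym , ≤1 , edge , bound′ , degree
      where
      ≤1 : ∀ u v → w (u , v) ≤ 1
      ≤1 u v with w⊑ (u , v)
      ... | inj₁ p = subst (_≤ 1) (sym p) z≤n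
      ... | inj₂ p = subst (_≤ 1) (sym p) (adjacency-≤1 (u , v))

      edge : ∀ u v → w (u , v) ≢ 0 → u ~ v
      edge u v ≢0 with w⊑ (u , v)
      ... | inj₁ p = ⊥-elim (≢0 p)
      ... | inj₂ p = adjacency⁻ (≢0 ∘ trans p)

      bound′ : ∑ pairs adjacency ≤ ∑ vs (λ v → ∑ vs (λ u → w (v , u))) + n * (δ + δ)
      bound′ = ≤-trans bound (+-mono-≤
        (≤-reflexive (∑-cartesianProductWith _,_ vs vs w)) (∑-bounded {n} _ (δ + δ) (λ _ → ≤-refl)))

      ∑-star : ∀ v → ∑ (star v) w ≡ ∑ vs (λ u → w (v , u)) + ∑ vs (λ u → w (v , u))
      ∑-star v = trans (∑-++ (map (v ,_) vs) (map (_, v) vs) w) (cong₂ _+_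
        (∑-map (v ,_) vs w)
        (trans (∑-map (_, v) vs w) (∑-cong vs (λ u → w-sym u v))))

      degree : ∀ v → ∑ vs (λ u → w (v , u)) ≢ 0 → δ < ∑ vs (λ u → w (v , u))
      degree v d≢0 with rich (∈-allFin v)
      ... | inj₁ p = ⊥-elim (d≢0 (m+n≡0⇒m≡0 _ (trans (sym (∑-star v)) p)))
      ... | inj₂ p = ≰⇒> λ d≤δ → <⇒≱ p (≤-trans (≤-reflexive (∑-star v)) (+-mono-≤ d≤δ d≤δ))

  -- A grid in a dense graph.

  contains-grid : ∀ t δ →
    (t + suc t) * (suc t * suc t) * (n * n) < suc δ * (∑ pairs adjacency ∸ n * (δ + δ)) →
    grid (suc t) IsSubgraphOf G
  contains-grid t δ dense
    with a , a-sym , a≤1 , edge , total , min-deg ← high-degrees δ = conclusion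
    where
    deg : V → ℕ
    deg v = ∑ vs (a v)

    -- Chosen so that `M` is divisible by every nonzero degree, with quotient at most `n !` as these
    -- degrees exceed `δ`.
    M = suc δ * n !

    deg≤n : ∀ v → deg v ≤ n
    deg≤n v = ≤-trans (∑-bounded (a v) 1 (a≤1 v)) (≤-reflexive (*-identityʳ n))

    step-weight : ∀ v → ∃[ q ] q ≤ n ! × (deg v ≢ 0 → q * deg v ≡ M)
    step-weight v with deg v ≟ 0
    ... | yes d≡0 = 0 , z≤n , λ d≢0 → ⊥-elim (d≢0 d≡0)
    ... | no  d≢0 with divides c n!≡c*d ← m∣n! d≢0 (deg≤n v) =
      suc δ * c , q≤n! , λ _ → trans (*-assoc (suc δ) c (deg v)) (cong (suc δ *_) (sym n!≡c*d))
      where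
      open ≤-Reasoning
      q≤n! : suc δ * c ≤ n !
      q≤n! = begin
        suc δ * c   ≤⟨ *-monoˡ-≤ c (min-deg v d≢0) ⟩
        deg v * c   ≡⟨ *-comm (deg v) c ⟩
        c * deg v   ≡⟨ n!≡c*d ⟨
        n !         ∎

    open Walks a a≤1 a-sym (proj₁ ∘ step-weight) M (n !)
      (proj₁ ∘ proj₂ ∘ step-weight) (λ v → proj₂ (proj₂ (step-weight v))) using (module Replacement)

    -- The grid has `s` cells and `suc p` diagonals.
    s p : ℕ
    s = suc t * suc t
    p = t + t

    -- Since `M` is `suc δ * n !`, the factor `n ! * M ^ p` cancels, and `dense` remains once the
    -- pairs lost to pruning are subtracted.
    cheap : suc p * (s * n ! * (n * n) * M ^ p) < ∑ vs deg * M ^ suc p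
    cheap = begin-strict
      suc p * (s * n ! * (n * n) * M ^ p)       ≡⟨ left (suc p) s (n !) (n * n) (M ^ p) ⟩
      suc p * s * (n * n) * (n ! * M ^ p)       <⟨ *-monoˡ-< (n ! * M ^ p) {{m*n≢0 (n !) (M ^ p)}} dense′ ⟩
      suc δ * ∑ vs deg * (n ! * M ^ p)          ≡⟨ right (suc δ) (∑ vs deg) (n !) (M ^ p) ⟩
      ∑ vs deg * M ^ suc p                      ∎
      where
      open ≤-Reasoning
      instance
        n!≢0 : NonZero (n !)
        n!≢0 = n !≢0
        M^p≢0 : NonZero (M ^ p)
        M^p≢0 = m^n≢0 M p {{m*n≢0 (suc δ) (n !)}}
      left : ∀ a b c d e → a * (b * c * d * e) ≡ a * b * d * (c * e)
      left = solve-∀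
      right : ∀ a b c d → a * b * (c * d) ≡ b * (a * c * d)
      right = solve-∀
      dense′ : suc p * s * (n * n) < suc δ * ∑ vs deg
      dense′ = begin-strict
        suc p * s * (n * n)                          ≡⟨ cong (λ k → k * s * (n * n)) (+-suc t t) ⟨
        (t + suc t) * s * (n * n)                    <⟨ dense ⟩
        suc δ * (∑ pairs adjacency ∸ n * (δ + δ))    ≤⟨ *-monoʳ-≤ (suc δ) loss ⟩
        suc δ * ∑ vs deg                             ∎
        where
        loss : ∑ pairs adjacency ∸ n * (δ + δ) ≤ ∑ vs deg
        loss = m≤n+o⇒m∸n≤o _ (n * (δ + δ)) (≤-trans total (≤-reflexive (+-comm (∑ vs deg) _)))

    conclusion : grid (suc t) IsSubgraphOf G
    conclusion
      with Good , (w , good , len) , adjacent , replace ← Replacement.flexible-words s p cheap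
      -- Of the `2t + 3` vertices, `t + 2` form the left part, an end and one vertex per row; the
      -- other `t + 1` are the initial row, which lies outside the grid.
      with l , r , refl , |l| , |r| ← split-ʳ++ (2 + t) [] w {suc t}
             (trans len (cong (2 +_) (sym (+-suc t t))))
      with row , refl ← as-tabulate r |r|
      with φ , _ , φ-inj , across , down , _ ←
        Sweep.sweep _~_ Good s (λ x l y r → edge x y ∘ adjacent x l y r) replace
          l row [] [] (trans |l| (cong suc (cong suc (+-identityʳ t)))) (n≤1+n s)
          (subst (λ k → Good (l ʳ++ k)) (sym (++-identityʳ (tabulate row))) good)
      = (λ (i , j) → φ i j) , φ-inj , hom
      where
      hom : ∀ {u v} → Graph._~_ (grid (suc t)) u v → φ (proj₁ u) (proj₂ u) ~ φ (proj₁ v) (proj₂ v)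
      hom {i , j} {_ , j′} (inj₁ (refl , near)) with distance-1 (toℕ j) (toℕ j′) near
      ... | inj₁ j′≡1+j = across i j′≡1+j
      ... | inj₂ j≡1+j′ = ~-sym (across i j≡1+j′)
      hom {i , j} {i′ , _} (inj₂ (near , refl)) with distance-1 (toℕ i) (toℕ i′) near
      ... | inj₁ i′≡1+i = ~-sym (down j i′≡1+i)
      ... | inj₂ i≡1+i′ = down j i≡1+i′

-- Choice of `δ` and the final bound.

threshold : ∀ k T n E A .{{_ : NonZero n}} → k ≤ T + T → E ≤ A → 25 * (T ^ 3 * n ^ 3) < E ^ 2 →
  ∃[ δ ] k * (T * T) * (n * n) < suc δ * (A ∸ n * (δ + δ))
threshold k T n E A k≤2T E≤A big = δ , ≰⇒> λ small → <⇒≱ big (begin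
  E ^ 2                                 ≡⟨ cong (E *_) (*-identityʳ E) ⟩
  E * E                                 ≤⟨ *-mono-≤ E≤2X E≤4nΔ ⟩
  (X + X) * (suc δ * (4 * n))           ≡⟨ collect X (suc δ) n ⟩
  8 * n * (suc δ * X)                   ≤⟨ *-monoʳ-≤ (8 * n) small ⟩
  8 * n * (k * (T * T) * (n * n))       ≤⟨ *-monoʳ-≤ (8 * n)
                                             (*-monoˡ-≤ (n * n) (*-monoˡ-≤ (T * T) k≤2T)) ⟩
  8 * n * ((T + T) * (T * T) * (n * n)) ≡⟨ expand n T ⟩
  -- The argument yields the constant 16; the difference 9 to 25 is slack.
  16 * (T ^ 3 * n ^ 3)                  ≤⟨ *-monoˡ-≤ (T ^ 3 * n ^ 3) (m≤m+n 16 9) ⟩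
  25 * (T ^ 3 * n ^ 3)                  ∎)
  where
  open ≤-Reasoning
  instance
    4n≢0 : NonZero (4 * n)
    4n≢0 = m*n≢0 4 n

  δ X : ℕ
  -- Pruning then loses at most `E / 2`, so `X` is at least `E / 2`, while `suc δ` is at least
  -- `E / (4n)`; their product is at least `E ^ 2 / (8n)`.
  δ = E / (4 * n)
  X = A ∸ n * (δ + δ)

  E≤4nΔ : E ≤ suc δ * (4 * n)
  E≤4nΔ = begin
    E                                  ≡⟨ m≡m%n+[m/n]*n E (4 * n) ⟩
    E % (4 * n) + δ * (4 * n)          ≤⟨ +-monoˡ-≤ (δ * (4 * n)) (<⇒≤ (m%n<n E (4 * n))) ⟩
    suc δ * (4 * n)                    ∎

  halve : ∀ n δ → δ * (4 * n) ≡ n * (δ + δ) + n * (δ + δ)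
  halve = solve-∀

  E≤2X : E ≤ X + X
  E≤2X = +-cancelʳ-≤ E E (X + X) (begin
    E + E                                          ≤⟨ +-mono-≤ E≤ E≤ ⟩
    n * (δ + δ) + X + (n * (δ + δ) + X)            ≡⟨ regroup (n * (δ + δ)) X ⟩
    X + X + (n * (δ + δ) + n * (δ + δ))            ≡⟨ cong (X + X +_) (halve n δ) ⟨
    X + X + δ * (4 * n)                            ≤⟨ +-monoʳ-≤ (X + X) (m/n*n≤m E (4 * n)) ⟩
    X + X + E                                      ∎)
    where
    E≤ : E ≤ n * (δ + δ) + X
    E≤ = ≤-trans E≤A (m≤n+m∸n A (n * (δ + δ)))
    regroup : ∀ a x → a + x + (a + x) ≡ x + x + (a + a)
    regroup = solve-∀

  collect : ∀ x d n → (x + x) * (d * (4 * n)) ≡ 8 * n * (d * x)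
  collect = solve-∀

  expand : ∀ n T →
    8 * n * ((T + T) * (T * T) * (n * n)) ≡ 16 * (T * (T * (T * 1)) * (n * (n * (n * 1))))
  expand = solve-∀

dense⇒grid : ∀ t {n} (G : Graph (Fin n)) → 25 * (suc t ^ 3 * n ^ 3) < edgeCount G ^ 2 →
             grid (suc t) IsSubgraphOf G
dense⇒grid t {zero}  G ()
dense⇒grid t {suc n} G big =
  let δ , dense = threshold (t + suc t) (suc t) (suc n) (edgeCount G) _
                    (+-monoˡ-≤ (suc t) (n≤1+n t)) (edgeCount-≤ G) big
  in contains-grid G t δ dense

theorem1p3 : ∀ (t : ℕ) → 1 ≤ t → ∃[ N ] (∀ (n : ℕ) → N ≤ n →
    ex n (gridVertices t) (grid t) ^ 2 ≤ 5 ^ 2 * (t ^ 3 * n ^ 3))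
-- The bound holds for every `n`, so 0 serves as the threshold.
theorem1p3 (suc t) _ = 0 , λ n _ → bound n
  where
  bound : ∀ n → ex n (gridVertices (suc t)) (grid (suc t)) ^ 2 ≤ 25 * (suc t ^ 3 * n ^ 3)
  bound n with ex n (gridVertices (suc t)) (grid (suc t)) in ex≡
  ... | zero  = z≤n
  -- If the square of `suc m` exceeded the bound, every graph with more than `m` edges would contain
  -- the grid, so the extremal number would be at most `m`.
  ... | suc m = ≮⇒≥ λ big → <⇒≱ (n<1+n m) (subst (_≤ m) ex≡
    (ex-least (gridVertices (suc t)) (grid (suc t)) n m λ G free →
      ≮⇒≥ λ m<e → free (dense⇒grid t G (<-≤-trans big (^-monoˡ-≤ 2 m<e)))))
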